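{- Let $k>5$ be an integer and let $G$ be a simple $2$-layer $k$-planar graph with $n\ge 4$ vertices and $m$ edges. Then $$m\ \le\ \max\left\{\frac{125}{48},\ \frac{125}{96}\sqrt{k}\right\}\cdot n .$$
   Context: All graphs are finite and simple (no loops or parallel edges). A topological $2$-layer graph is a bipartite graph $G=(U\,\dot\cup\,V,E)$, $E\subseteq U\times V$, drawn in the plane so that the vertices of $U$ and of $V$ are distinct points on two horizontal lines $L_u$ and $L_v$, respectively, and edges are $y$-monotone Jordan arcs; the drawing is assumed simple, i.e. adjacent edges do not cross and independent edges cross at most once. Denote the vertices by $u_1,\dots,u_p$ along $L_u$ and $v_1,\dots,v_q$ along $L_v$ in left-to-right order, $n=p+q$. (Thus edges $(u_i,v_x)$ and $(u_j,v_y)$ with $i<j$ cross if and only if $x>y$.) A topological $2$-layer graph is $k$-planar if each edge is crossed at most $k$ times. A bipartite graph is $2$-layer $k$-planar if it is isomorphic to the underlying abstract graph of some topological $2$-layer $k$-planar graph. -}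

module Defs where

open import Data.Nat using (ℕ) renaming (_≤_ to _≤ℕ_)
open import Data.Fin using (Fin; _<_)
open import Data.Fin.Properties using (_<?_)
open import Data.Integer using (+_)
open import Data.List using (List; length; filter; allFin; cartesianProduct)
open import Data.Product using (_×_; _,_; Σ-syntax)
open import Data.Rational using (ℚ; 0ℚ; _/_; _≤_; _*_)
open import Data.Sum using (_⊎_; inj₁; inj₂)
open import Data.Empty using (⊥)
open import Function.Bundles using (_↔_; _⇔_; Inverse)
open import Relation.Binary using (Symmetric; Decidable)
open import Relation.Nullary using (¬_; no)
open import Relation.Nullary.Decidable using (_×-dec_; _⊎-dec_)

record Graph (V : Set) : Set₁ where
  field
    Adj     : V → V → Set
    adj?    : Decidable Adj
    sym     : Symmetric Adj
    irrefl  : ∀ {v} → ¬ Adj v v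

record _≅_ {V W : Set} (G : Graph V) (H : Graph W) : Set where
  field
    vertices : V ↔ W
    adjacent : ∀ u v →
      Graph.Adj G u v ⇔ Graph.Adj H (Inverse.to vertices u) (Inverse.to vertices v)

-- Each edge {u,v} is listed once, as the pair with u < v.
edges : ∀ {n} → Graph (Fin n) → List (Fin n × Fin n)
edges {n} G =
  filter (λ (u , v) → (u <? v) ×-dec Graph.adj? G u v)
         (cartesianProduct (allFin n) (allFin n))

numEdges : ∀ {n} → Graph (Fin n) → ℕ
numEdges G = length (edges G)

-- A simple topological 2-layer graph, up to the combinatorial data that
-- determine its crossings: Fin p and Fin q are the vertices on L_u and L_v in
-- left-to-right order.  As edges are y-monotone, adjacent edges do not cross
-- and independent edges cross at most once, two edges cross exactly when
-- their endpoints appear in opposite orders on the two lines; and every such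
-- datum is realised by a simple drawing (with straight-line segments and the
-- vertices in general position).
record Drawing (p q : ℕ) : Set₁ where
  field
    Edge  : Fin p → Fin q → Set
    edge? : Decidable Edge

Crosses : ∀ {p q} → Fin p × Fin q → Fin p × Fin q → Set
Crosses (i , x) (j , y) = (i < j × y < x) ⊎ (j < i × x < y)

crosses? : ∀ {p q} → Decidable (Crosses {p} {q})
crosses? (i , x) (j , y) =
  ((i <? j) ×-dec (y <? x)) ⊎-dec ((j <? i) ×-dec (x <? y))

module _ {p q : ℕ} (D : Drawing p q) where
  open Drawing D

  drawnEdges : List (Fin p × Fin q)
  drawnEdges =
    filter (λ (i , x) → edge? i x) (cartesianProduct (allFin p) (allFin q))

  numCrossings : Fin p × Fin q → ℕ
  numCrossings e = length (filter (crosses? e) drawnEdges)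

  IsKPlanarDrawing : ℕ → Set
  IsKPlanarDrawing k = ∀ i x → Edge i x → numCrossings (i , x) ≤ℕ k

  underlying : Graph (Fin p ⊎ Fin q)
  underlying = record
    { Adj    = Adj
    ; adj?   = adj?
    ; sym    = λ {a} {b} → symAdj a b
    ; irrefl = λ {a} → irreflAdj a
    }
    where
    Adj : Fin p ⊎ Fin q → Fin p ⊎ Fin q → Set
    Adj (inj₁ i) (inj₂ x) = Edge i x
    Adj (inj₂ x) (inj₁ i) = Edge i x
    Adj (inj₁ _) (inj₁ _) = ⊥
    Adj (inj₂ _) (inj₂ _) = ⊥

    adj? : Decidable Adj
    adj? (inj₁ i) (inj₂ x) = edge? i x
    adj? (inj₂ x) (inj₁ i) = edge? i x
    adj? (inj₁ _) (inj₁ _) = no λ ()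
    adj? (inj₂ _) (inj₂ _) = no λ ()

    symAdj : ∀ a b → Adj a b → Adj b a
    symAdj (inj₁ _) (inj₂ _) e = e
    symAdj (inj₂ _) (inj₁ _) e = e

    irreflAdj : ∀ a → ¬ Adj a a
    irreflAdj (inj₁ _) ()
    irreflAdj (inj₂ _) ()

TwoLayerKPlanar : {V : Set} → ℕ → Graph V → Set₁
TwoLayerKPlanar k G =
  Σ[ p ∈ ℕ ] Σ[ q ∈ ℕ ] Σ[ D ∈ Drawing p q ]
    (IsKPlanarDrawing D k × G ≅ underlying D)

fromℕ : ℕ → ℚ
fromℕ a = + a / 1

-- The rational s satisfies √k ≤ s, i.e. s lies in the closed upper cut of the
-- real number √k.  For a continuous nondecreasing f, the real inequality
-- a ≤ f (√k) holds iff a ≤ f s for every rational s with √k ≤ s.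
√_≤ℚ_ : ℕ → ℚ → Set
√ k ≤ℚ s = 0ℚ ≤ s × fromℕ k ≤ s * s

{-# OPTIONS --safe #-}
module Submission where

-- View the edges as points of a p × q grid; two edges cross iff the points form an
-- inversion. For a point let a and r be the numbers of points further along in its
-- column and row. Each inversion is seen from at most one point as a pair of one of these
-- a and one of these r points, so there are at least Σ r a inversions. For every t,
-- 2 r a ≥ t (t + 1) - w a - w r with w z = (t ∸ z) (t + 1 ∸ z); within a column a takes
-- each of the values 0, 1, 2, ... at most once, so there Σ w a ≤ t (t + 1) (t + 2) / 3,
-- and likewise for rows. As the number of inversions is at most k m / 2, this gives
--   t (t + 1) m ≤ k m + n t (t + 1) (t + 2) / 3,
-- and the theorem follows by taking t minimal with 25 k ≤ 9 t (t + 1).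

open import Data.Nat using (ℕ) renaming (_≤_ to _≤ℕ_; _>_ to _>ℕ_; _≥_ to _≥ℕ_)
open import Data.Fin using (Fin)
open import Data.Integer using (+_)
open import Data.Rational using (ℚ; _/_; _≤_; _*_; _⊔_)
open import Defs

open import Algebra.Bundles using (CommutativeMonoid)
open import Data.Bool using (Bool; true; false; if_then_else_)
open import Data.Fin using (zero; suc; _↑ˡ_; _↑ʳ_; splitAt; join)
open import Data.Fin.Permutation using (↔⇒≡)
open import Data.Fin.Properties using (_<?_; <-asym; +↔⊎; splitAt-↑ˡ; splitAt-↑ʳ; splitAt-join)
open import Data.Integer using (+≤+)
import Data.Integer.Properties as ℤ
open import Data.List using (List; []; _∷_; length; filter; map; _++_; tabulate; allFin; cartesianProduct)
open import Data.List.Properties using (filter-++; length-++; map-tabulate)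
open import Data.Nat using (zero; suc; pred; _+_; _∸_; z≤n; s≤s) renaming (_*_ to _*ℕ_; _<_ to _<ℕ_)
import Data.Nat.Properties as ℕ
open import Data.Nat.Tactic.RingSolver using (solve-∀)
open import Data.Product using (_×_; _,_; ∃-syntax)
open import Data.Rational using (0ℚ; toℚᵘ; NonNegative; nonNegative; positive)
import Data.Rational.Properties as ℚₚ
open import Data.Rational.Unnormalised as ℚᵘ using (mkℚᵘ)
import Data.Rational.Unnormalised.Properties as ℚᵘₚ
open import Data.Sum using (_⊎_; inj₁; inj₂)
open import Function using (_∘_; Inverse; _↔_; _⇔_; mk⇔)
open import Function.Construct.Composition using (_↔-∘_)
open import Function.Construct.Symmetry using (↔-sym)
open import Relation.Binary.PropositionalEquality
open import Relation.Nullary using (¬_; Dec; does; yes; no; _because_; contradiction)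
open import Relation.Nullary.Decidable using (_×-dec_; _⊎-dec_; does-⇔)
open import Relation.Unary using (Decidable)

open import Algebra.Properties.Semiring.Sum ℕ.+-*-semiring
  using (sum; sum-syntax; sum-cong-≗; sum-replicate-zero; ∑-distrib-+; ∑-comm; sum-permute
        ; *-distribˡ-sum; *-distribʳ-sum)

open import Algebra.Properties.CommutativeSemigroup
  (CommutativeMonoid.commutativeSemigroup ℚₚ.*-1-commutativeMonoid) using (interchange)

-- Indicators and finite sums.

χ : Bool → ℕ
χ b = if b then 1 else 0

𝟙 : ∀ {P : Set} → Dec P → ℕ
𝟙 P? = χ (does P?)

χ≤1 : ∀ b → χ b ≤ℕ 1
χ≤1 true  = s≤s z≤n
χ≤1 false = z≤n

𝟙-× : ∀ {P Q : Set} (P? : Dec P) (Q? : Dec Q) → 𝟙 (P? ×-dec Q?) ≡ 𝟙 P? *ℕ 𝟙 Q?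
𝟙-× (true  because _) Q? = sym (ℕ.+-identityʳ _)
𝟙-× (false because _) Q? = refl

𝟙-exclusive : ∀ {P Q : Set} → (P → ¬ Q) → (P? : Dec P) (Q? : Dec Q) → 𝟙 P? + 𝟙 Q? ≤ℕ 𝟙 (P? ⊎-dec Q?)
𝟙-exclusive P⇒¬Q (yes p) (yes q) = contradiction q (P⇒¬Q p)
𝟙-exclusive P⇒¬Q (yes p) (no ¬q) = ℕ.≤-refl
𝟙-exclusive P⇒¬Q (no ¬p) Q?      = ℕ.≤-refl

sum-mono-≤ : ∀ {n} {f g : Fin n → ℕ} → (∀ i → f i ≤ℕ g i) → sum f ≤ℕ sum g
sum-mono-≤ {zero}  f≤g = z≤n
sum-mono-≤ {suc n} f≤g = ℕ.+-mono-≤ (f≤g zero) (sum-mono-≤ (f≤g ∘ suc))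

sum-const : ∀ n c → ∑[ i < n ] c ≡ n *ℕ c
sum-const zero    c = refl
sum-const (suc n) c = cong₂ _+_ refl (sum-const n c)

sum-↑ : ∀ p {q} (f : Fin (p + q) → ℕ) →
        sum f ≡ ∑[ i < p ] f (i ↑ˡ q) + ∑[ x < q ] f (p ↑ʳ x)
sum-↑ zero    f = refl
sum-↑ (suc p) f = trans (cong₂ _+_ refl (sum-↑ p (f ∘ suc))) (sym (ℕ.+-assoc (f zero) _ _))

-- Lengths of filtered lists as sums of indicators.

length-filter-tabulate : ∀ {A : Set} {P : A → Set} (P? : Decidable P) {n} (f : Fin n → A) →
  length (filter P? (tabulate f)) ≡ ∑[ i < n ] 𝟙 (P? (f i))
length-filter-tabulate P? {zero}  f = refl
length-filter-tabulate P? {suc n} f with does (P? (f zero))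
... | true  = cong suc (length-filter-tabulate P? (f ∘ suc))
... | false = length-filter-tabulate P? (f ∘ suc)

length-filter-grid : ∀ {A B : Set} {P : A × B → Set} (P? : Decidable P) {p q}
  (f : Fin p → A) (g : Fin q → B) →
  length (filter P? (cartesianProduct (tabulate f) (tabulate g))) ≡
  ∑[ i < p ] ∑[ x < q ] 𝟙 (P? (f i , g x))
length-filter-grid P? {zero}  f g = refl
length-filter-grid {A} {B} {P} P? {suc p} f g = begin
  length (filter P? (row ++ rest))                     ≡⟨ cong length (filter-++ P? row rest) ⟩
  length (filter P? row ++ filter P? rest)             ≡⟨ length-++ (filter P? row) ⟩
  length (filter P? row) + length (filter P? rest)     ≡⟨ cong₂ _+_ row-length (length-filter-grid P? (f ∘ suc) g) ⟩
  ∑[ i < suc p ] ∑[ x < _ ] 𝟙 (P? (f i , g x))         ∎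
  where
  open ≡-Reasoning
  row rest : List (A × B)
  row  = map (λ x → f zero , x) (tabulate g)
  rest = cartesianProduct (tabulate (f ∘ suc)) (tabulate g)
  row-length = trans (cong (length ∘ filter P?) (map-tabulate g (λ x → f zero , x)))
                     (length-filter-tabulate P? (λ x → f zero , g x))

length-filter-filter : ∀ {A : Set} {P Q : A → Set} (P? : Decidable P) (Q? : Decidable Q) xs →
  length (filter Q? (filter P? xs)) ≡ length (filter (λ a → P? a ×-dec Q? a) xs)
length-filter-filter P? Q? []       = refl
length-filter-filter P? Q? (a ∷ xs) with does (P? a)
... | false = length-filter-filter P? Q? xs
... | true with does (Q? a)
...   | true  = cong suc (length-filter-filter P? Q? xs)
...   | false = length-filter-filter P? Q? xs

-- Weights and their telescoping sums.

-- Truncated subtraction is intended: the weight vanishes from `a = t` on, so the total over a row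
-- or column stays bounded however many points it has.
weight : ℕ → ℕ → ℕ
weight t a = (t ∸ a) *ℕ (suc t ∸ a)

-- For `r ≤ t + 1`, raising `t` by one adds exactly `2 (t + 1 - r)` to the weight, so equality
-- holds; for larger `r` both weights vanish and `t + 1 ≤ r` remains.
weight-suc : ∀ t r → suc t *ℕ 2 + weight t r ≤ℕ r *ℕ 2 + weight (suc t) r
weight-suc t zero = ℕ.≤-reflexive (lemma t)
  where
  lemma : ∀ t → suc t *ℕ 2 + t *ℕ suc t ≡ suc t *ℕ suc (suc t)
  lemma = solve-∀
weight-suc zero    (suc r) = s≤s (s≤s z≤n)
weight-suc (suc t) (suc r) = s≤s (s≤s (weight-suc t r))

-- For a, r ≤ t the difference of the two sides is y (y - 1) with y = a + r - t.
weight-bound : ∀ t a r → t *ℕ suc t ≤ℕ 2 *ℕ (r *ℕ a) + weight t a + weight t r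
weight-bound t zero r = begin
  t *ℕ suc t                             ≤⟨ ℕ.m≤n+m _ _ ⟩
  2 *ℕ (r *ℕ 0) + t *ℕ suc t             ≤⟨ ℕ.m≤m+n _ _ ⟩
  2 *ℕ (r *ℕ 0) + t *ℕ suc t + weight t r ∎
  where open ℕ.≤-Reasoning
weight-bound zero    (suc a) r = z≤n
-- Lowering `t` and `a` together leaves the weight of `a` unchanged by computation, so only the
-- weight of `r` has to be adjusted, by `weight-suc`.
weight-bound (suc t) (suc a) r = begin
  suc t *ℕ suc (suc t)                                                   ≡⟨ lhs t ⟩
  suc t *ℕ 2 + t *ℕ suc t                                                ≤⟨ ℕ.+-monoʳ-≤ (suc t *ℕ 2) (weight-bound t a r) ⟩
  suc t *ℕ 2 + (2 *ℕ (r *ℕ a) + weight t a + weight t r)                 ≡⟨ mid (suc t *ℕ 2) (2 *ℕ (r *ℕ a) + weight t a) (weight t r) ⟩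
  2 *ℕ (r *ℕ a) + weight t a + (suc t *ℕ 2 + weight t r)                 ≤⟨ ℕ.+-monoʳ-≤ (2 *ℕ (r *ℕ a) + weight t a) (weight-suc t r) ⟩
  2 *ℕ (r *ℕ a) + weight t a + (r *ℕ 2 + weight (suc t) r)               ≡⟨ rhs r a (weight t a) (weight (suc t) r) ⟩
  2 *ℕ (r *ℕ suc a) + weight t a + weight (suc t) r                      ∎
  where
  open ℕ.≤-Reasoning
  lhs : ∀ t → suc t *ℕ suc (suc t) ≡ suc t *ℕ 2 + t *ℕ suc t
  lhs = solve-∀
  mid : ∀ u v w → u + (v + w) ≡ v + (u + w)
  mid = solve-∀
  rhs : ∀ r a v w → 2 *ℕ (r *ℕ a) + v + (r *ℕ 2 + w) ≡ 2 *ℕ (r *ℕ suc a) + v + w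
  rhs = solve-∀

-- Three times the sum of `j (j + 1)` over `j ≤ u`. Keeping the factor 3 avoids division and
-- accounts for the 3 in the bounds below.
rising : ℕ → ℕ
rising u = u *ℕ suc u *ℕ suc (suc u)

above : ∀ {n} → (Fin n → Bool) → Fin n → ℕ
above {n} b i = ∑[ j < n ] (χ (b j) *ℕ 𝟙 (i <? j))

-- The telescoping step: `rising u` and `rising (u - 1)` differ by `3 u (u + 1)`, here with
-- `u = t ∸ c`; once `c ≥ t`, every term is zero.
rising-∸ : ∀ t c → 3 *ℕ weight t c + rising (t ∸ suc c) ≡ rising (t ∸ c)
rising-∸ zero    zero    = refl
rising-∸ zero    (suc c) = refl
rising-∸ (suc t) (suc c) = rising-∸ t c
rising-∸ (suc t) zero    = lemma t
  where
  lemma : ∀ t → 3 *ℕ (suc t *ℕ suc (suc t)) + t *ℕ suc t *ℕ suc (suc t) ≡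
                suc t *ℕ suc (suc t) *ℕ suc (suc (suc t))
  lemma = solve-∀

above-zero : ∀ {n} (b : Fin (suc n) → Bool) → above b zero ≡ sum (χ ∘ b ∘ suc)
above-zero b rewrite ℕ.*-zeroʳ (χ (b zero)) = sum-cong-≗ (λ j → ℕ.*-identityʳ (χ (b (suc j))))

above-suc : ∀ {n} (b : Fin (suc n) → Bool) i → above b (suc i) ≡ above (b ∘ suc) i
above-suc b i rewrite ℕ.*-zeroʳ (χ (b zero)) = refl

-- The above-counts of the members of b are 0, 1, ..., |b| - 1, so the sum telescopes.
sum-weight : ∀ t {n} (b : Fin n → Bool) →
  3 *ℕ ∑[ i < n ] (χ (b i) *ℕ weight t (above b i)) + rising (t ∸ sum (χ ∘ b)) ≡ rising t
sum-weight t {zero}  b = refl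
sum-weight t {suc n} b
  rewrite above-zero b
        | sum-cong-≗ (λ i → cong (λ a → χ (b (suc i)) *ℕ weight t a) (above-suc b i))
  with b zero
... | false = sum-weight t (b ∘ suc)
-- A member in first position has all `c` other members above it, so it contributes `weight t c`,
-- the next term of the telescope.
... | true  = begin
  3 *ℕ (weight t c + 0 + s) + rising (t ∸ suc c)      ≡⟨ lemma (weight t c) s (rising (t ∸ suc c)) ⟩
  3 *ℕ s + (3 *ℕ weight t c + rising (t ∸ suc c))     ≡⟨ cong₂ _+_ refl (rising-∸ t c) ⟩
  3 *ℕ s + rising (t ∸ c)                             ≡⟨ sum-weight t (b ∘ suc) ⟩
  rising t                                            ∎
  where
  open ≡-Reasoning
  c = sum (χ ∘ b ∘ suc)
  s = ∑[ i < n ] (χ (b (suc i)) *ℕ weight t (above (b ∘ suc) i))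
  lemma : ∀ w s v → 3 *ℕ (w + 0 + s) + v ≡ 3 *ℕ s + (3 *ℕ w + v)
  lemma = solve-∀

sum-weight-≤ : ∀ t {n} (b : Fin n → Bool) →
  3 *ℕ ∑[ i < n ] (χ (b i) *ℕ weight t (above b i)) ≤ℕ rising t
sum-weight-≤ t b = ℕ.m+n≤o⇒m≤o _ (ℕ.≤-reflexive (sum-weight t b))

-- Double sums.

∑∑ : ∀ {p q} → (Fin p → Fin q → ℕ) → ℕ
∑∑ f = sum (λ i → sum (f i))

∑∑-cong : ∀ {p q} {f g : Fin p → Fin q → ℕ} → (∀ i x → f i x ≡ g i x) → ∑∑ f ≡ ∑∑ g
∑∑-cong f≡g = sum-cong-≗ (λ i → sum-cong-≗ (f≡g i))

∑∑-mono-≤ : ∀ {p q} {f g : Fin p → Fin q → ℕ} → (∀ i x → f i x ≤ℕ g i x) → ∑∑ f ≤ℕ ∑∑ g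
∑∑-mono-≤ f≤g = sum-mono-≤ (λ i → sum-mono-≤ (f≤g i))

∑∑-distrib-+ : ∀ {p q} (f g : Fin p → Fin q → ℕ) → ∑∑ (λ i x → f i x + g i x) ≡ ∑∑ f + ∑∑ g
∑∑-distrib-+ f g = trans (sum-cong-≗ (λ i → ∑-distrib-+ (f i) (g i))) (∑-distrib-+ (sum ∘ f) (sum ∘ g))

*-distribˡ-∑∑ : ∀ {p q} c (f : Fin p → Fin q → ℕ) → c *ℕ ∑∑ f ≡ ∑∑ (λ i x → c *ℕ f i x)
*-distribˡ-∑∑ c f = trans (*-distribˡ-sum c (sum ∘ f)) (sum-cong-≗ (λ i → *-distribˡ-sum c (f i)))

sum-*-sum : ∀ {p q} (f : Fin p → ℕ) (g : Fin q → ℕ) → sum f *ℕ sum g ≡ ∑∑ (λ i x → f i *ℕ g x)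
sum-*-sum f g = trans (*-distribʳ-sum (sum g) f) (sum-cong-≗ (λ i → *-distribˡ-sum (f i) g))

∑∑-comm : ∀ {p q p′ q′} (F : Fin p → Fin q → Fin p′ → Fin q′ → ℕ) →
  ∑∑ (λ i x → ∑∑ (F i x)) ≡ ∑∑ (λ j y → ∑∑ (λ i x → F i x j y))
∑∑-comm F = begin
  sum (λ i → sum (λ x → sum (λ j → sum (λ y → F i x j y))))  ≡⟨ sum-cong-≗ (λ i → ∑-comm (λ x j → sum (F i x j))) ⟩
  sum (λ i → sum (λ j → sum (λ x → sum (λ y → F i x j y))))  ≡⟨ ∑-comm (λ i j → ∑∑ (λ x y → F i x j y)) ⟩
  sum (λ j → sum (λ i → sum (λ x → sum (λ y → F i x j y))))  ≡⟨ ∑∑-cong (λ j i → ∑-comm (λ x y → F i x j y)) ⟩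
  sum (λ j → sum (λ i → sum (λ y → sum (λ x → F i x j y))))  ≡⟨ sum-cong-≗ (λ j → ∑-comm (λ i y → sum (λ x → F i x j y))) ⟩
  sum (λ j → sum (λ y → sum (λ i → sum (λ x → F i x j y))))  ∎
  where open ≡-Reasoning

-- Inversions in a 0-1 matrix.

module _ {p q : ℕ} (b : Fin p → Fin q → Bool) where

  rowAbove columnAbove : Fin p → Fin q → ℕ
  rowAbove    i x = above (b i) x
  columnAbove i x = above (λ j → b j x) i

  size : ℕ
  size = ∑∑ (λ i x → χ (b i x))

  -- Oriented by `i < j`, so that the sum over all quadruples counts each crossing pair once.
  inversion : Fin p → Fin q → Fin p → Fin q → ℕ
  inversion i x j y = χ (b i x) *ℕ (χ (b j y) *ℕ (𝟙 (i <? j) *ℕ 𝟙 (y <? x)))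

  inversions : ℕ
  inversions = ∑∑ (λ i x → ∑∑ (inversion i x))

  -- An inversion {(i , x) , (j , y)} is counted at its corner (i , y), if that is present.
  corners≤inversions : ∑∑ (λ i y → χ (b i y) *ℕ (rowAbove i y *ℕ columnAbove i y)) ≤ℕ inversions
  corners≤inversions = begin
    ∑∑ (λ i y → χ (b i y) *ℕ (rowAbove i y *ℕ columnAbove i y))         ≤⟨ ∑∑-mono-≤ bound ⟩
    ∑∑ (λ i y → ∑∑ (λ x j → inversion i x j y))                         ≡⟨ sum-cong-≗ reorder ⟨
    inversions                                                          ∎
    where
    open ℕ.≤-Reasoning
    regroup : ∀ u v w z → u *ℕ v *ℕ (w *ℕ z) ≡ u *ℕ (w *ℕ (z *ℕ v))
    regroup = solve-∀
    bound : ∀ i y → χ (b i y) *ℕ (rowAbove i y *ℕ columnAbove i y) ≤ℕ ∑∑ (λ x j → inversion i x j y)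
    bound i y = begin
      -- Without the factor for the corner itself, the product counts all inversions with corner
      -- `(i , y)`, whether or not that point is present.
      χ (b i y) *ℕ (rowAbove i y *ℕ columnAbove i y)  ≤⟨ ℕ.*-monoˡ-≤ (rowAbove i y *ℕ columnAbove i y) (χ≤1 (b i y)) ⟩
      1 *ℕ (rowAbove i y *ℕ columnAbove i y)          ≡⟨ ℕ.*-identityˡ _ ⟩
      rowAbove i y *ℕ columnAbove i y                 ≡⟨ sum-*-sum (λ x → χ (b i x) *ℕ 𝟙 (y <? x)) (λ j → χ (b j y) *ℕ 𝟙 (i <? j)) ⟩
      ∑∑ (λ x j → χ (b i x) *ℕ 𝟙 (y <? x) *ℕ (χ (b j y) *ℕ 𝟙 (i <? j)))
        ≡⟨ ∑∑-cong (λ x j → regroup (χ (b i x)) (𝟙 (y <? x)) (χ (b j y)) (𝟙 (i <? j))) ⟩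
      ∑∑ (λ x j → inversion i x j y)                  ∎
    reorder : ∀ i → ∑∑ (λ x j → sum (inversion i x j)) ≡ ∑∑ (λ y x → sum (λ j → inversion i x j y))
    reorder i = trans (sum-cong-≗ (λ x → ∑-comm (inversion i x))) (∑-comm (λ x y → sum (λ j → inversion i x j y)))

  crossing : Fin p → Fin q → Fin p → Fin q → ℕ
  crossing i x j y = χ (b j y) *ℕ (𝟙 (i <? j) *ℕ 𝟙 (y <? x) + 𝟙 (j <? i) *ℕ 𝟙 (x <? y))

  crossings : Fin p → Fin q → ℕ
  crossings i x = ∑∑ (crossing i x)

  -- Double counting: each crossing pair is seen from both of its edges. The two alternatives in
  -- `crossing` are the two orientations of an inversion, and interchanging the two edges turns one
  -- into the other.
  total-crossings : ∑∑ (λ i x → χ (b i x) *ℕ crossings i x) ≡ 2 *ℕ inversions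
  total-crossings = begin
    ∑∑ (λ i x → χ (b i x) *ℕ crossings i x)                              ≡⟨ ∑∑-cong split ⟩
    ∑∑ (λ i x → ∑∑ (inversion i x) + ∑∑ (λ j y → inversion j y i x))     ≡⟨ ∑∑-distrib-+ (λ i x → ∑∑ (inversion i x)) _ ⟩
    inversions + ∑∑ (λ i x → ∑∑ (λ j y → inversion j y i x))             ≡⟨ cong₂ _+_ {x = inversions} refl (∑∑-comm inversion) ⟨
    inversions + inversions                                              ≡⟨ cong₂ _+_ {x = inversions} refl (ℕ.+-identityʳ inversions) ⟨
    2 *ℕ inversions                                                      ∎
    where
    open ≡-Reasoning
    expand : ∀ u v w z → u *ℕ (v *ℕ (w + z)) ≡ u *ℕ (v *ℕ w) + v *ℕ (u *ℕ z)
    expand = solve-∀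
    split : ∀ i x → χ (b i x) *ℕ crossings i x ≡ ∑∑ (inversion i x) + ∑∑ (λ j y → inversion j y i x)
    split i x = begin
      χ (b i x) *ℕ crossings i x  ≡⟨ *-distribˡ-∑∑ (χ (b i x)) (crossing i x) ⟩
      ∑∑ (λ j y → χ (b i x) *ℕ crossing i x j y)
        ≡⟨ ∑∑-cong (λ j y → expand (χ (b i x)) (χ (b j y)) (𝟙 (i <? j) *ℕ 𝟙 (y <? x)) (𝟙 (j <? i) *ℕ 𝟙 (x <? y))) ⟩
      ∑∑ (λ j y → inversion i x j y + inversion j y i x)  ≡⟨ ∑∑-distrib-+ (inversion i x) _ ⟩
      ∑∑ (inversion i x) + ∑∑ (λ j y → inversion j y i x) ∎

  rows-weight : ∀ t → 3 *ℕ ∑∑ (λ i x → χ (b i x) *ℕ weight t (rowAbove i x)) ≤ℕ p *ℕ rising t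
  rows-weight t = begin
    3 *ℕ ∑∑ (λ i x → χ (b i x) *ℕ weight t (rowAbove i x))         ≡⟨ *-distribˡ-sum 3 (λ i → ∑[ x < q ] (χ (b i x) *ℕ weight t (rowAbove i x))) ⟩
    ∑[ i < p ] (3 *ℕ ∑[ x < q ] (χ (b i x) *ℕ weight t (rowAbove i x)))  ≤⟨ sum-mono-≤ (λ i → sum-weight-≤ t (b i)) ⟩
    ∑[ i < p ] rising t                                             ≡⟨ sum-const p (rising t) ⟩
    p *ℕ rising t                                                   ∎
    where open ℕ.≤-Reasoning

-- The row bound for the transposed matrix, whose row counts are by definition the column counts of
-- `b`.
columns-weight : ∀ {p q} (b : Fin p → Fin q → Bool) t →
  3 *ℕ ∑∑ (λ i x → χ (b i x) *ℕ weight t (columnAbove b i x)) ≤ℕ q *ℕ rising t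
columns-weight {q = q} b t = subst (λ s → 3 *ℕ s ≤ℕ q *ℕ rising t)
  (∑-comm (λ x i → χ (b i x) *ℕ weight t (columnAbove b i x))) (rows-weight (λ x i → b i x) t)

-- `weight-bound` is summed over all points present. The products of counts total at most the number
-- of inversions, and each row and each column contributes at most `rising t` to three times the
-- weights.
inversions-bound : ∀ {p q} (b : Fin p → Fin q → Bool) t →
  3 *ℕ (t *ℕ suc t *ℕ size b) ≤ℕ 3 *ℕ (2 *ℕ inversions b) + (p + q) *ℕ rising t
inversions-bound {p} {q} b t = begin
  3 *ℕ (t *ℕ suc t *ℕ size b)
    ≡⟨ cong (3 *ℕ_) (*-distribˡ-∑∑ (t *ℕ suc t) (λ i x → χ (b i x))) ⟩
  3 *ℕ ∑∑ (λ i x → t *ℕ suc t *ℕ χ (b i x))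
    ≤⟨ ℕ.*-monoʳ-≤ 3 (∑∑-mono-≤ pointwise) ⟩
  3 *ℕ ∑∑ (λ i x → 2 *ℕ corner i x + column i x + row i x)
    ≡⟨ cong (3 *ℕ_) sums ⟩
  3 *ℕ (2 *ℕ ∑∑ corner + ∑∑ column + ∑∑ row)
    ≡⟨ regroup (∑∑ corner) (∑∑ column) (∑∑ row) ⟩
  3 *ℕ (2 *ℕ ∑∑ corner) + (3 *ℕ ∑∑ row + 3 *ℕ ∑∑ column)
    ≤⟨ ℕ.+-mono-≤ (ℕ.*-monoʳ-≤ 3 (ℕ.*-monoʳ-≤ 2 (corners≤inversions b)))
                  (ℕ.+-mono-≤ (rows-weight b t) (columns-weight b t)) ⟩
  3 *ℕ (2 *ℕ inversions b) + (p *ℕ rising t + q *ℕ rising t)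
    ≡⟨ cong₂ _+_ {x = 3 *ℕ (2 *ℕ inversions b)} refl (ℕ.*-distribʳ-+ (rising t) p q) ⟨
  3 *ℕ (2 *ℕ inversions b) + (p + q) *ℕ rising t ∎
  where
  open ℕ.≤-Reasoning
  corner column row : Fin p → Fin q → ℕ
  corner i x = χ (b i x) *ℕ (rowAbove b i x *ℕ columnAbove b i x)
  column i x = χ (b i x) *ℕ weight t (columnAbove b i x)
  row    i x = χ (b i x) *ℕ weight t (rowAbove b i x)
  expand : ∀ c u v w → c *ℕ (2 *ℕ u + v + w) ≡ 2 *ℕ (c *ℕ u) + c *ℕ v + c *ℕ w
  expand = solve-∀
  regroup : ∀ u v w → 3 *ℕ (2 *ℕ u + v + w) ≡ 3 *ℕ (2 *ℕ u) + (3 *ℕ w + 3 *ℕ v)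
  regroup = solve-∀
  pointwise : ∀ i x → t *ℕ suc t *ℕ χ (b i x) ≤ℕ 2 *ℕ corner i x + column i x + row i x
  pointwise i x = begin
    t *ℕ suc t *ℕ χ (b i x)  ≡⟨ ℕ.*-comm (t *ℕ suc t) (χ (b i x)) ⟩
    χ (b i x) *ℕ (t *ℕ suc t) ≤⟨ ℕ.*-monoʳ-≤ (χ (b i x)) (weight-bound t (columnAbove b i x) (rowAbove b i x)) ⟩
    _                        ≡⟨ expand (χ (b i x)) (rowAbove b i x *ℕ columnAbove b i x) (weight t (columnAbove b i x)) (weight t (rowAbove b i x)) ⟩
    _                        ∎
  sums : ∑∑ (λ i x → 2 *ℕ corner i x + column i x + row i x) ≡ 2 *ℕ ∑∑ corner + ∑∑ column + ∑∑ row
  sums = begin-equality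
    ∑∑ (λ i x → 2 *ℕ corner i x + column i x + row i x)            ≡⟨ ∑∑-distrib-+ (λ i x → 2 *ℕ corner i x + column i x) row ⟩
    ∑∑ (λ i x → 2 *ℕ corner i x + column i x) + ∑∑ row             ≡⟨ cong (λ s → s + ∑∑ row) (∑∑-distrib-+ (λ i x → 2 *ℕ corner i x) column) ⟩
    ∑∑ (λ i x → 2 *ℕ corner i x) + ∑∑ column + ∑∑ row              ≡⟨ cong (λ s → s + ∑∑ column + ∑∑ row) (*-distribˡ-∑∑ 2 corner) ⟨
    2 *ℕ ∑∑ corner + ∑∑ column + ∑∑ row                            ∎

-- The density inequality for k-planar drawings.

module _ {p q : ℕ} (D : Drawing p q) where
  open Drawing D

  incidence : Fin p → Fin q → Bool
  incidence i x = does (edge? i x)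

  -- The two ways of crossing exclude each other, as `i < j` and `j < i` cannot both hold, so their
  -- indicators add up to at most the indicator of the disjunction.
  crossings≤numCrossings : ∀ i x → crossings incidence i x ≤ℕ numCrossings D (i , x)
  crossings≤numCrossings i x = begin
    ∑∑ (crossing incidence i x)                                      ≤⟨ ∑∑-mono-≤ (λ j y → ℕ.*-monoʳ-≤ (𝟙 (edge? j y)) (bound i x j y)) ⟩
    ∑∑ (λ j y → 𝟙 (edge? j y) *ℕ 𝟙 (crosses? (i , x) (j , y)))       ≡⟨ ∑∑-cong (λ j y → 𝟙-× (edge? j y) (crosses? (i , x) (j , y))) ⟨
    ∑∑ (λ j y → 𝟙 (edge? j y ×-dec crosses? (i , x) (j , y)))        ≡⟨ length-filter-grid (λ (j , y) → edge? j y ×-dec crosses? (i , x) (j , y)) (λ j → j) (λ y → y) ⟨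
    length (filter (λ (j , y) → edge? j y ×-dec crosses? (i , x) (j , y)) grid)  ≡⟨ length-filter-filter (λ (j , y) → edge? j y) (crosses? (i , x)) grid ⟨
    numCrossings D (i , x)                                           ∎
    where
    open ℕ.≤-Reasoning
    bound : ∀ (i : Fin p) (x : Fin q) j y →
      𝟙 (i <? j) *ℕ 𝟙 (y <? x) + 𝟙 (j <? i) *ℕ 𝟙 (x <? y) ≤ℕ 𝟙 (crosses? (i , x) (j , y))
    bound i x j y rewrite sym (𝟙-× (i <? j) (y <? x)) | sym (𝟙-× (j <? i) (x <? y)) =
      𝟙-exclusive (λ (i<j , _) (j<i , _) → <-asym i<j j<i) ((i <? j) ×-dec (y <? x)) ((j <? i) ×-dec (x <? y))
    grid = cartesianProduct (allFin p) (allFin q)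

  2*inversions≤ : ∀ {k} → IsKPlanarDrawing D k → 2 *ℕ inversions incidence ≤ℕ k *ℕ size incidence
  2*inversions≤ {k} planar = begin
    2 *ℕ inversions incidence                                 ≡⟨ total-crossings incidence ⟨
    ∑∑ (λ i x → 𝟙 (edge? i x) *ℕ crossings incidence i x)     ≤⟨ ∑∑-mono-≤ bound ⟩
    ∑∑ (λ i x → k *ℕ 𝟙 (edge? i x))                           ≡⟨ *-distribˡ-∑∑ k (λ i x → 𝟙 (edge? i x)) ⟨
    k *ℕ size incidence                                       ∎
    where
    open ℕ.≤-Reasoning
    bound : ∀ i x → 𝟙 (edge? i x) *ℕ crossings incidence i x ≤ℕ k *ℕ 𝟙 (edge? i x)
    -- With the indicator moved to the front on both sides, the case split evaluates both products;
    -- a non-edge contributes zero.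
    bound i x rewrite ℕ.*-comm k (𝟙 (edge? i x)) with edge? i x
    ... | yes e = ℕ.*-monoʳ-≤ 1 (ℕ.≤-trans (crossings≤numCrossings i x) (planar i x e))
    ... | no _  = z≤n

  density : ∀ {k} → IsKPlanarDrawing D k → ∀ t →
    3 *ℕ (t *ℕ suc t *ℕ size incidence) ≤ℕ 3 *ℕ (k *ℕ size incidence) + (p + q) *ℕ rising t
  density planar t = ℕ.≤-trans (inversions-bound incidence t)
    (ℕ.+-monoˡ-≤ ((p + q) *ℕ rising t) (ℕ.*-monoʳ-≤ 3 (2*inversions≤ planar)))

-- Edge counts under isomorphism.

↔-+ : ∀ {n p q} → Fin n ↔ (Fin p ⊎ Fin q) → n ≡ p + q
↔-+ π = ↔⇒≡ (↔-sym +↔⊎ ↔-∘ π)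

-- The disjoint union is identified with `Fin (p + q)`, where reindexing along a bijection applies
-- and the sum splits into two blocks.
sum-↔-⊎ : ∀ {n p q} (π : Fin n ↔ (Fin p ⊎ Fin q)) (h : Fin p ⊎ Fin q → ℕ) →
  sum (λ u → h (Inverse.to π u)) ≡ sum (h ∘ inj₁) + sum (h ∘ inj₂)
sum-↔-⊎ {n} {p} {q} π h = begin
  sum (λ u → h (Inverse.to π u))                             ≡⟨ sum-cong-≗ (λ u → cong h (splitAt-join p q (Inverse.to π u))) ⟨
  sum (λ u → h (splitAt p (join p q (Inverse.to π u))))      ≡⟨ sum-permute (h ∘ splitAt p) (↔-sym +↔⊎ ↔-∘ π) ⟨
  sum (h ∘ splitAt p)                                        ≡⟨ sum-↑ p (h ∘ splitAt p) ⟩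
  sum (λ i → h (splitAt p (i ↑ˡ q))) + sum (λ x → h (splitAt p (p ↑ʳ x)))
    ≡⟨ cong₂ _+_ (sum-cong-≗ (λ i → cong h (splitAt-↑ˡ p i q))) (sum-cong-≗ (λ x → cong h (splitAt-↑ʳ p q x))) ⟩
  sum (h ∘ inj₁) + sum (h ∘ inj₂)                            ∎
  where open ≡-Reasoning

𝟙-⇔ : ∀ {P Q : Set} → P ⇔ Q → (P? : Dec P) (Q? : Dec Q) → 𝟙 P? ≡ 𝟙 Q?
𝟙-⇔ P⇔Q P? Q? = cong χ (does-⇔ P⇔Q P? Q?)

module _ {n : ℕ} (G : Graph (Fin n)) where
  open Graph G using (adj?) renaming (sym to adj-sym)

  -- Listing edges by `u < v` depends on the labelling, while the count of ordered adjacent pairs is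
  -- invariant under isomorphism. By symmetry each listed edge yields two such pairs.
  2*numEdges≤ : 2 *ℕ numEdges G ≤ℕ ∑∑ (λ u v → 𝟙 (adj? u v))
  2*numEdges≤ = begin
    2 *ℕ numEdges G                                              ≡⟨ cong (2 *ℕ_) count ⟩
    2 *ℕ ∑∑ upper                                                ≡⟨ cong₂ _+_ {x = ∑∑ upper} refl (trans (ℕ.+-identityʳ (∑∑ upper)) (∑-comm upper)) ⟩
    ∑∑ upper + ∑∑ (λ u v → upper v u)                            ≡⟨ ∑∑-distrib-+ upper (λ u v → upper v u) ⟨
    ∑∑ (λ u v → upper u v + upper v u)                           ≤⟨ ∑∑-mono-≤ bound ⟩
    ∑∑ (λ u v → 𝟙 (adj? u v))                                    ∎
    where
    open ℕ.≤-Reasoning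
    upper : Fin n → Fin n → ℕ
    upper u v = 𝟙 (u <? v) *ℕ 𝟙 (adj? u v)
    count : numEdges G ≡ ∑∑ upper
    count = trans (length-filter-grid (λ (u , v) → (u <? v) ×-dec adj? u v) (λ u → u) (λ v → v))
                  (∑∑-cong (λ u v → 𝟙-× (u <? v) (adj? u v)))
    bound : ∀ u v → upper u v + upper v u ≤ℕ 𝟙 (adj? u v)
    bound u v = begin
      upper u v + upper v u                              ≡⟨ cong (λ z → upper u v + 𝟙 (v <? u) *ℕ z) (𝟙-⇔ (mk⇔ adj-sym adj-sym) (adj? v u) (adj? u v)) ⟩
      upper u v + 𝟙 (v <? u) *ℕ 𝟙 (adj? u v)             ≡⟨ ℕ.*-distribʳ-+ (𝟙 (adj? u v)) (𝟙 (u <? v)) (𝟙 (v <? u)) ⟨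
      (𝟙 (u <? v) + 𝟙 (v <? u)) *ℕ 𝟙 (adj? u v)          ≤⟨ ℕ.*-monoˡ-≤ (𝟙 (adj? u v)) (ℕ.≤-trans (𝟙-exclusive <-asym (u <? v) (v <? u)) (χ≤1 _)) ⟩
      1 *ℕ 𝟙 (adj? u v)                                  ≡⟨ ℕ.*-identityˡ _ ⟩
      𝟙 (adj? u v)                                       ∎

numEdges≤size : ∀ {n p q} (G : Graph (Fin n)) (D : Drawing p q) → G ≅ underlying D →
  numEdges G ≤ℕ size (incidence D)
numEdges≤size {n} {p} {q} G D iso = ℕ.*-cancelˡ-≤ 2 (begin
  2 *ℕ numEdges G                                        ≤⟨ 2*numEdges≤ G ⟩
  ∑∑ (λ u v → 𝟙 (Graph.adj? G u v))                      ≡⟨ ∑∑-cong (λ u v → 𝟙-⇔ (adjacent u v) (Graph.adj? G u v) (Graph.adj? (underlying D) (to u) (to v))) ⟩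
  sum (λ u → sum (λ v → a (to u) (to v)))                ≡⟨ sum-cong-≗ (λ u → sum-↔-⊎ vertices (a (to u))) ⟩
  sum (λ u → sum (a (to u) ∘ inj₁) + sum (a (to u) ∘ inj₂))
    ≡⟨ sum-↔-⊎ vertices (λ w → sum (a w ∘ inj₁) + sum (a w ∘ inj₂)) ⟩
  -- The adjacency matrix of the drawn graph in four blocks: the diagonal ones vanish, the others
  -- are the incidence matrix and its transpose.
  sum {p} (λ i → sum {p} (λ _ → 0) + sum (e i)) + sum {q} (λ x → sum (λ i → e i x) + sum {q} (λ _ → 0))
    ≡⟨ cong₂ _+_ (sum-cong-≗ (λ i → cong (λ z → z + sum (e i)) (sum-replicate-zero p)))
                 (sum-cong-≗ (λ x → trans (cong₂ _+_ {x = sum (λ i → e i x)} refl (sum-replicate-zero q)) (ℕ.+-identityʳ _))) ⟩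
  ∑∑ e + ∑∑ (λ x i → e i x)                              ≡⟨ cong₂ _+_ {x = ∑∑ e} refl (trans (∑-comm (λ x i → e i x)) (sym (ℕ.+-identityʳ (∑∑ e)))) ⟩
  2 *ℕ ∑∑ e                                              ∎)
  where
  open ℕ.≤-Reasoning
  open _≅_ iso
  to = Inverse.to vertices
  a : Fin p ⊎ Fin q → Fin p ⊎ Fin q → ℕ
  a w z = 𝟙 (Graph.adj? (underlying D) w z)
  e : Fin p → Fin q → ℕ
  e i x = χ (incidence D i x)

-- The choice of t.

-- The threshold 25 k ≤ 9 t (t + 1), where t = r + 1, is the one for which the density bound
-- becomes m / n ≤ 25/48 (t + 2), so that 125/96 s is reached exactly when 2 (t + 2) ≤ 5 s.
linear-bound : ∀ k m n r → 25 *ℕ k ≤ℕ 9 *ℕ (suc r *ℕ suc (suc r)) →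
  3 *ℕ (suc r *ℕ suc (suc r) *ℕ m) ≤ℕ 3 *ℕ (k *ℕ m) + n *ℕ rising (suc r) →
  48 *ℕ m ≤ℕ 25 *ℕ (3 + r) *ℕ n
linear-bound k m n r 25k≤9y bound = ℕ.*-cancelˡ-≤ y (ℕ.+-cancelʳ-≤ (9 *ℕ y *ℕ (3 *ℕ m)) _ _ (begin
  -- Here `y = t (t + 1)` and `75 y m = 48 y m + 27 y m`. As `25 k ≤ 9 y`, the crossing term
  -- `75 k m` is at most `27 y m`, which cancels.
  y *ℕ (48 *ℕ m) + 9 *ℕ y *ℕ (3 *ℕ m)                  ≡⟨ lhs y m ⟩
  25 *ℕ (3 *ℕ (y *ℕ m))                                ≤⟨ ℕ.*-monoʳ-≤ 25 bound ⟩
  25 *ℕ (3 *ℕ (k *ℕ m) + n *ℕ (y *ℕ (3 + r)))          ≡⟨ mid y k m n (3 + r) ⟩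
  y *ℕ (25 *ℕ (3 + r) *ℕ n) + 25 *ℕ k *ℕ (3 *ℕ m)      ≤⟨ ℕ.+-monoʳ-≤ (y *ℕ (25 *ℕ (3 + r) *ℕ n)) (ℕ.*-monoˡ-≤ (3 *ℕ m) 25k≤9y) ⟩
  y *ℕ (25 *ℕ (3 + r) *ℕ n) + 9 *ℕ y *ℕ (3 *ℕ m)       ∎))
  where
  open ℕ.≤-Reasoning
  y = suc r *ℕ suc (suc r)
  lhs : ∀ y m → y *ℕ (48 *ℕ m) + 9 *ℕ y *ℕ (3 *ℕ m) ≡ 25 *ℕ (3 *ℕ (y *ℕ m))
  lhs = solve-∀
  mid : ∀ y k m n u → 25 *ℕ (3 *ℕ (k *ℕ m) + n *ℕ (y *ℕ u)) ≡ y *ℕ (25 *ℕ u *ℕ n) + 25 *ℕ k *ℕ (3 *ℕ m)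
  mid = solve-∀

-- The least `t = r + 1` whose threshold `9 t (t + 1)` reaches `suc N`. The successor matters, since
-- no `r` meets the strict lower bound at 0. Consecutive thresholds differ by more than one, so `r`
-- advances by at most one as `N` does.
pronic-bracket : ∀ N → ∃[ r ] (9 *ℕ (r *ℕ suc r) <ℕ suc N × suc N ≤ℕ 9 *ℕ (suc r *ℕ suc (suc r)))
pronic-bracket zero    = 0 , s≤s z≤n , s≤s z≤n
pronic-bracket (suc N) with pronic-bracket N
... | r , lower , upper with suc (suc N) ℕ.≤? 9 *ℕ (suc r *ℕ suc (suc r))
...   | yes N≤ = r , ℕ.m<n⇒m<1+n lower , N≤
...   | no  N≰ = suc r , ℕ.≰⇒> N≰ , ℕ.≤-trans (s≤s upper) (begin
  -- The slack is the gap `18 r + 36` to the next threshold, less one.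
  suc (9 *ℕ (suc r *ℕ suc (suc r)))                   ≤⟨ ℕ.m≤m+n _ (18 *ℕ r + 35) ⟩
  suc (9 *ℕ (suc r *ℕ suc (suc r))) + (18 *ℕ r + 35)  ≡⟨ lemma r ⟩
  9 *ℕ (suc (suc r) *ℕ suc (suc (suc r)))             ∎)
  where
  open ℕ.≤-Reasoning
  lemma : ∀ r → suc (9 *ℕ (suc r *ℕ suc (suc r))) + (18 *ℕ r + 35) ≡ 9 *ℕ (suc (suc r) *ℕ suc (suc (suc r)))
  lemma = solve-∀

-- This is `2 (t + 2) ≤ 5 √k`, squared, for `t = r + 1`. From `k ≥ 6` follows `25 k ≥ 150`, which
-- rules out `r ≤ 2`, where the upper bound is at most 108, and settles `r = 3`, where 144 is
-- required.
square-bound : ∀ k r → 5 <ℕ k → 9 *ℕ (r *ℕ suc r) <ℕ 25 *ℕ k → 25 *ℕ k ≤ℕ 9 *ℕ (suc r *ℕ suc (suc r)) →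
  2 *ℕ (3 + r) *ℕ (2 *ℕ (3 + r)) ≤ℕ 25 *ℕ k
square-bound k 0 5<k _ upper = contradiction (ℕ.≤-trans (ℕ.*-monoʳ-≤ 25 5<k) upper) (ℕ.<⇒≱ (ℕ.m≤m+n 19 131))
square-bound k 1 5<k _ upper = contradiction (ℕ.≤-trans (ℕ.*-monoʳ-≤ 25 5<k) upper) (ℕ.<⇒≱ (ℕ.m≤m+n 55 95))
square-bound k 2 5<k _ upper = contradiction (ℕ.≤-trans (ℕ.*-monoʳ-≤ 25 5<k) upper) (ℕ.<⇒≱ (ℕ.m≤m+n 109 41))
square-bound k 3 5<k _ _     = ℕ.≤-trans (ℕ.m≤m+n 144 6) (ℕ.*-monoʳ-≤ 25 5<k)
-- The bound 180 falls short of the required 196, but integrality helps: `25 k > 180` forces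
-- `k ≥ 8`, so `25 k ≥ 200`.
square-bound k 4 _ 180<25k _ = ℕ.≤-trans (ℕ.m≤m+n 196 4) (ℕ.*-monoʳ-≤ 25 (ℕ.*-cancelˡ-< 25 7 k (ℕ.≤-trans (ℕ.m≤m+n 176 5) 180<25k)))
-- From `r = 5` on, `9 r (r + 1)` itself exceeds `4 (r + 3)²`.
square-bound k (suc (suc (suc (suc (suc z))))) _ lower _ = begin
  2 *ℕ (8 + z) *ℕ (2 *ℕ (8 + z))                                 ≤⟨ ℕ.m≤m+n _ _ ⟩
  2 *ℕ (8 + z) *ℕ (2 *ℕ (8 + z)) + (5 *ℕ (z *ℕ z) + 35 *ℕ z + 14)  ≡⟨ identity z ⟩
  9 *ℕ ((5 + z) *ℕ (6 + z))                                      ≤⟨ ℕ.<⇒≤ lower ⟩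
  25 *ℕ k                                                        ∎
  where
  open ℕ.≤-Reasoning
  identity : ∀ z → 2 *ℕ (8 + z) *ℕ (2 *ℕ (8 + z)) + (5 *ℕ (z *ℕ z) + 35 *ℕ z + 14) ≡ 9 *ℕ ((5 + z) *ℕ (6 + z))
  identity = solve-∀

-- Transfer to the rationals.

fromℕ-* : ∀ a b → fromℕ (a *ℕ b) ≡ fromℕ a * fromℕ b
fromℕ-* a b = ℚₚ.toℚᵘ-injective (begin
  toℚᵘ (fromℕ (a *ℕ b))                    ≈⟨ ℚₚ.toℚᵘ-fromℚᵘ (mkℚᵘ (+ (a *ℕ b)) 0) ⟩
  mkℚᵘ (+ (a *ℕ b)) 0                      ≡⟨ cong (λ z → mkℚᵘ z 0) (ℤ.pos-* a b) ⟩
  mkℚᵘ (+ a) 0 ℚᵘ.* mkℚᵘ (+ b) 0           ≈⟨ ℚᵘₚ.*-cong (ℚₚ.toℚᵘ-fromℚᵘ (mkℚᵘ (+ a) 0)) (ℚₚ.toℚᵘ-fromℚᵘ (mkℚᵘ (+ b) 0)) ⟨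
  toℚᵘ (fromℕ a) ℚᵘ.* toℚᵘ (fromℕ b)       ≈⟨ ℚₚ.toℚᵘ-homo-* (fromℕ a) (fromℕ b) ⟨
  toℚᵘ (fromℕ a * fromℕ b)                 ∎)
  where open import Relation.Binary.Reasoning.Setoid ℚᵘₚ.≃-setoid

fromℕ-mono-≤ : ∀ {a b} → a ≤ℕ b → fromℕ a ≤ fromℕ b
fromℕ-mono-≤ {a} {b} a≤b = ℚₚ.toℚᵘ-cancel-≤ (begin
  toℚᵘ (fromℕ a)   ≃⟨ ℚₚ.toℚᵘ-fromℚᵘ (mkℚᵘ (+ a) 0) ⟩
  mkℚᵘ (+ a) 0     ≤⟨ ℚᵘ.*≤* (ℤ.*-monoʳ-≤-nonNeg (+ 1) (+≤+ a≤b)) ⟩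
  mkℚᵘ (+ b) 0     ≃⟨ ℚₚ.toℚᵘ-fromℚᵘ (mkℚᵘ (+ b) 0) ⟨
  toℚᵘ (fromℕ b)   ∎)
  where open ℚᵘₚ.≤-Reasoning

fromℕ-nonNegative : ∀ a → NonNegative (fromℕ a)
fromℕ-nonNegative a = nonNegative (fromℕ-mono-≤ {0} {a} z≤n)

square-cancel-≤ : ∀ {u v} → 0ℚ ≤ v → u * u ≤ v * v → u ≤ v
square-cancel-≤ {u} {v} 0≤v u²≤v² = ℚₚ.≮⇒≥ λ v<u → ℚₚ.<-irrefl refl (begin-strict
  v * v  ≤⟨ ℚₚ.*-monoˡ-≤-nonNeg v {{nonNegative 0≤v}} (ℚₚ.<⇒≤ v<u) ⟩
  v * u  <⟨ ℚₚ.*-monoˡ-<-pos u {{positive (ℚₚ.≤-<-trans 0≤v v<u)}} v<u ⟩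
  u * u  ≤⟨ u²≤v² ⟩
  v * v  ∎)
  where open ℚₚ.≤-Reasoning

-- Since √k is known only through `k ≤ s * s`, squares are compared: `c² ≤ d² k ≤ (d s)²`.
√-bound : ∀ c d k {s} → √ k ≤ℚ s → c *ℕ c ≤ℕ d *ℕ d *ℕ k → fromℕ c ≤ fromℕ d * s
√-bound c d k {s} (0≤s , k≤s²) c²≤d²k = square-cancel-≤ 0≤ds (begin
  fromℕ c * fromℕ c                    ≡⟨ fromℕ-* c c ⟨
  fromℕ (c *ℕ c)                       ≤⟨ fromℕ-mono-≤ c²≤d²k ⟩
  fromℕ (d *ℕ d *ℕ k)                  ≡⟨ fromℕ-* (d *ℕ d) k ⟩
  fromℕ (d *ℕ d) * fromℕ k             ≤⟨ ℚₚ.*-monoˡ-≤-nonNeg (fromℕ (d *ℕ d)) {{fromℕ-nonNegative (d *ℕ d)}} k≤s² ⟩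
  fromℕ (d *ℕ d) * (s * s)             ≡⟨ cong (λ z → z * (s * s)) (fromℕ-* d d) ⟩
  fromℕ d * fromℕ d * (s * s)          ≡⟨ interchange (fromℕ d) (fromℕ d) s s ⟩
  fromℕ d * s * (fromℕ d * s)          ∎)
  where
  open ℚₚ.≤-Reasoning
  0≤ds = ℚₚ.≤-trans (ℚₚ.≤-reflexive (sym (ℚₚ.*-zeroʳ (fromℕ d)))) (ℚₚ.*-monoˡ-≤-nonNeg (fromℕ d) {{fromℕ-nonNegative d}} 0≤s)

rational-bound : ∀ m n u s → 48 *ℕ m ≤ℕ 25 *ℕ u *ℕ n → fromℕ (2 *ℕ u) ≤ fromℕ 5 * s →
  fromℕ m ≤ (+ 125 / 96) * s * fromℕ n
rational-bound m n u s 48m≤25un 2u≤5s = ℚₚ.*-cancelˡ-≤-pos (fromℕ 96) (begin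
  fromℕ 96 * fromℕ m                            ≡⟨ fromℕ-* 96 m ⟨
  fromℕ (96 *ℕ m)                               ≤⟨ fromℕ-mono-≤ 96m≤ ⟩
  fromℕ (25 *ℕ n *ℕ (2 *ℕ u))                   ≡⟨ fromℕ-* (25 *ℕ n) (2 *ℕ u) ⟩
  fromℕ (25 *ℕ n) * fromℕ (2 *ℕ u)              ≤⟨ ℚₚ.*-monoˡ-≤-nonNeg (fromℕ (25 *ℕ n)) {{fromℕ-nonNegative (25 *ℕ n)}} 2u≤5s ⟩
  fromℕ (25 *ℕ n) * (fromℕ 5 * s)               ≡⟨ cong (λ z → z * (fromℕ 5 * s)) (fromℕ-* 25 n) ⟩
  -- Besides regrouping, this step uses that `25 * 5` and `96 * (125 / 96)` evaluate to the same
  -- rational.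
  fromℕ 25 * fromℕ n * (fromℕ 5 * s)            ≡⟨ interchange (fromℕ 25) (fromℕ n) (fromℕ 5) s ⟩
  fromℕ 96 * (+ 125 / 96) * (fromℕ n * s)       ≡⟨ ℚₚ.*-assoc (fromℕ 96) (+ 125 / 96) (fromℕ n * s) ⟩
  fromℕ 96 * ((+ 125 / 96) * (fromℕ n * s))     ≡⟨ cong (λ z → fromℕ 96 * ((+ 125 / 96) * z)) (ℚₚ.*-comm (fromℕ n) s) ⟩
  fromℕ 96 * ((+ 125 / 96) * (s * fromℕ n))     ≡⟨ cong (fromℕ 96 *_) (ℚₚ.*-assoc (+ 125 / 96) s (fromℕ n)) ⟨
  fromℕ 96 * ((+ 125 / 96) * s * fromℕ n)       ∎)
  where
  open ℚₚ.≤-Reasoning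
  lhs : ∀ m → 96 *ℕ m ≡ 2 *ℕ (48 *ℕ m)
  lhs = solve-∀
  rhs : ∀ u n → 2 *ℕ (25 *ℕ u *ℕ n) ≡ 25 *ℕ n *ℕ (2 *ℕ u)
  rhs = solve-∀
  96m≤ : 96 *ℕ m ≤ℕ 25 *ℕ n *ℕ (2 *ℕ u)
  96m≤ = subst₂ _≤ℕ_ (sym (lhs m)) (rhs u n) (ℕ.*-monoʳ-≤ 2 48m≤25un)

-- Assembling the bound.

size-bound : ∀ {p q k} (D : Drawing p q) → IsKPlanarDrawing D k → 5 <ℕ k → ∀ {s} → √ k ≤ℚ s →
  fromℕ (size (incidence D)) ≤ (+ 125 / 96) * s * fromℕ (p + q)
-- Matching `k` as a successor lets `suc (pred (25 *ℕ k))` compute to `25 *ℕ k`, so the bracket has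
-- the form needed.
size-bound {p} {q} {k@(suc _)} D planar 5<k {s} √k≤s with pronic-bracket (pred (25 *ℕ k))
... | r , lower , upper = rational-bound m (p + q) (3 + r) s
  (linear-bound k m (p + q) r upper (density D planar (suc r)))
  (√-bound (2 *ℕ (3 + r)) 5 k √k≤s (square-bound k r 5<k lower upper))
  where m = size (incidence D)

corollary2 : ∀ (k n : ℕ) (G : Graph (Fin n)) → k >ℕ 5 → n ≥ℕ 4 → TwoLayerKPlanar k G →
    ∀ (s : ℚ) → √ k ≤ℚ s →
    fromℕ (numEdges G) ≤ ((+ 125 / 48) ⊔ ((+ 125 / 96) * s)) * fromℕ n
corollary2 k n G k>5 _ (p , q , D , planar , iso) s √k≤s = begin
  fromℕ (numEdges G)                                    ≤⟨ fromℕ-mono-≤ (numEdges≤size G D iso) ⟩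
  fromℕ (size (incidence D))                            ≤⟨ size-bound D planar k>5 √k≤s ⟩
  (+ 125 / 96) * s * fromℕ (p + q)                      ≡⟨ cong (λ n → (+ 125 / 96) * s * fromℕ n) (↔-+ (_≅_.vertices iso)) ⟨
  (+ 125 / 96) * s * fromℕ n                            ≤⟨ ℚₚ.*-monoʳ-≤-nonNeg (fromℕ n) {{fromℕ-nonNegative n}} (ℚₚ.p≤q⊔p (+ 125 / 48) ((+ 125 / 96) * s)) ⟩
  ((+ 125 / 48) ⊔ ((+ 125 / 96) * s)) * fromℕ n         ∎
  where open ℚₚ.≤-Reasoning
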